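{- Let $k > 1$ and $p > 1$ be integers. The cycle graph $C_{k^p+1}$ on $k^p+1$ vertices has weak periodicity number $p$ under the $k$-distance operator, i.e. $\varrho^k(C_{k^p+1}) = p$.
   Context: Graphs are simple and undirected; $d_G(u,v)$ denotes geodesic distance (length of a shortest path) in $G$. For $k>1$, the $k$-distance operator $D^k$ sends a graph $G$ to the graph $D^k(G)$ on the same vertex set in which $u,v$ are adjacent if and only if $d_G(u,v)=k$. Set $G_1^k = G$ and $G_t^k = D^k(G_{t-1}^k)$ for $t>1$ (so $G_t^k$ results from $t-1$ applications of $D^k$), all on the same labeled vertex set. Write $G \equiv H$ (labeled isomorphism) if $G$ and $H$ are isomorphic with the labels of their vertices preserved, i.e. they have the same vertex set and the same edge set. The weak periodicity number $\varrho^k(G)$ is $f-1$, where $f>1$ is the least integer such that $G_f^k \equiv G_1^k$; if no such $f$ exists, $\varrho^k(G)=0$. -}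

module Defs where

open import Data.Fin.Base using (Fin; toℕ)
open import Data.List.Base using (List; []; _∷_; _∷ʳ_)
open import Data.List.Relation.Binary.Permutation.Propositional
  using (_↭_; prep; ↭-sym; ↭-trans; ↭-reflexive; ↭⇒↭ₛ)
open import Data.List.Relation.Binary.Permutation.Propositional.Properties
  using (∷↭∷ʳ)
import Data.List.Relation.Binary.Permutation.Setoid.Properties as Permutationₛ
open import Data.List.Relation.Unary.All using ([])
open import Data.List.Relation.Unary.AllPairs using ([]; _∷_)
open import Data.List.Relation.Unary.Unique.Propositional using (Unique)
open import Data.Nat.Base using (ℕ; zero; suc; _∸_; _≤_; _<_; z≤n; NonTrivial)
open import Data.Nat.Properties using (≤-antisym)
open import Data.Product.Base using (Σ; _×_; _,_)
open import Data.Sum.Base using (_⊎_; swap)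
open import Function.Base using (_∘_)
open import Function.Bundles using (_⇔_)
open import Relation.Binary.PropositionalEquality
  using (_≡_; _≢_; refl; sym; cong; setoid; ≢-sym)
open import Relation.Nullary.Negation using (¬_; contradiction)

record Graph (V : Set) : Set₁ where
  field
    Adj        : V → V → Set
    adj-sym    : ∀ {u v} → Adj u v → Adj v u
    adj-irrefl : ∀ {u} → ¬ Adj u u

module _ {V : Set} where

  open Graph

  -- Equality of edge sets on a fixed labeled vertex set.  It is stated with ⇔
  -- because edges are types, which may have more than one inhabitant.
  infix 4 _≡ᴳ_
  _≡ᴳ_ : Graph V → Graph V → Set
  G ≡ᴳ H = ∀ u v → Adj G u v ⇔ Adj H u v

  data Walk (G : Graph V) : ℕ → V → V → Set where
    []  : ∀ {u} → Walk G 0 u u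
    _∷_ : ∀ {ℓ u v w} → Adj G u v → Walk G ℓ v w → Walk G (suc ℓ) u w

  vertices : ∀ {G ℓ u v} → Walk G ℓ u v → List V
  vertices {u = u} []      = u ∷ []
  vertices {u = u} (_ ∷ w) = u ∷ vertices w

  Path : Graph V → ℕ → V → V → Set
  Path G ℓ u v = Σ (Walk G ℓ u v) (Unique ∘ vertices)

  -- Distance G u v d means d_G(u,v) = d.  As a relation it needs neither
  -- connectedness nor decidable adjacency.
  Distance : Graph V → V → V → ℕ → Set
  Distance G u v d = Path G d u v × (∀ {ℓ} → Path G ℓ u v → d ≤ ℓ)

  module _ {G : Graph V} where

    snoc : ∀ {ℓ u v w} → Walk G ℓ u v → Adj G v w → Walk G (suc ℓ) u w
    snoc []      a = a ∷ []
    snoc (b ∷ p) a = b ∷ snoc p a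

    reverse : ∀ {ℓ u v} → Walk G ℓ u v → Walk G ℓ v u
    reverse []      = []
    reverse (a ∷ p) = snoc (reverse p) (adj-sym G a)

    vertices-snoc : ∀ {ℓ u v w} (p : Walk G ℓ u v) (a : Adj G v w) →
                    vertices (snoc p a) ≡ vertices p ∷ʳ w
    vertices-snoc []      a = refl
    vertices-snoc (b ∷ p) a = cong (_ ∷_) (vertices-snoc p a)

    vertices-reverse : ∀ {ℓ u v} (p : Walk G ℓ u v) →
                       vertices p ↭ vertices (reverse p)
    vertices-reverse []              = ↭-reflexive refl
    vertices-reverse {u = u} (a ∷ p) =
      ↭-trans (prep u (vertices-reverse p))
        (↭-trans (∷↭∷ʳ u (vertices (reverse p)))
          (↭-reflexive (sym (vertices-snoc (reverse p) (adj-sym G a)))))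

    reversePath : ∀ {ℓ u v} → Path G ℓ u v → Path G ℓ v u
    reversePath (p , uniq) =
      reverse p ,
      Permutationₛ.Unique-resp-↭ (setoid V) (↭⇒↭ₛ (vertices-reverse p)) uniq

    Distance-sym : ∀ {u v d} → Distance G u v d → Distance G v u d
    Distance-sym (p , min) = reversePath p , (min ∘ reversePath)

    Distance-refl : ∀ {u} → Distance G u u 0
    Distance-refl = ([] , [] ∷ []) , λ _ → z≤n

    Distance-unique : ∀ {u v c d} → Distance G u v c → Distance G u v d → c ≡ d
    Distance-unique (p , min-p) (q , min-q) = ≤-antisym (min-p q) (min-q p)

  D : (k : ℕ) .{{_ : NonTrivial k}} → Graph V → Graph V
  D k G = record
    { Adj        = λ u v → Distance G u v k
    ; adj-sym    = Distance-sym
    ; adj-irrefl = λ dist → k≢0 k (Distance-unique dist Distance-refl)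
    }
    where
    k≢0 : ∀ m .{{_ : NonTrivial m}} → m ≢ 0
    k≢0 (suc _) ()

  -- iterateD k G t is G_t^k, the result of t ∸ 1 applications of D k.  The
  -- sequence starts at t = 1; its value at t = 0 is a dummy and is never used.
  iterateD : (k : ℕ) .{{_ : NonTrivial k}} → Graph V → ℕ → Graph V
  iterateD k G zero          = G
  iterateD k G (suc zero)    = G
  iterateD k G (suc (suc t)) = D k (iterateD k G (suc t))

  Returns : (k : ℕ) .{{_ : NonTrivial k}} → Graph V → ℕ → Set
  Returns k G f = 1 < f × iterateD k G f ≡ᴳ iterateD k G 1

  -- WeakPeriodicity k G r means ϱᵏ(G) = r.  Whether some f returns is not
  -- decidable for arbitrary G, so ϱ is given by its graph, which is
  -- single-valued by WeakPeriodicity-unique.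
  data WeakPeriodicity (k : ℕ) .{{_ : NonTrivial k}} (G : Graph V) : ℕ → Set where
    periodic  : ∀ {f} → Returns k G f → (∀ {g} → Returns k G g → f ≤ g) →
                WeakPeriodicity k G (f ∸ 1)
    aperiodic : (∀ f → ¬ Returns k G f) → WeakPeriodicity k G 0

  WeakPeriodicity-unique : ∀ {k} .{{_ : NonTrivial k}} {G r s} →
    WeakPeriodicity k G r → WeakPeriodicity k G s → r ≡ s
  WeakPeriodicity-unique (periodic x min-x) (periodic y min-y) =
    cong (_∸ 1) (≤-antisym (min-x y) (min-y x))
  WeakPeriodicity-unique (periodic x _)  (aperiodic n)  = contradiction x (n _)
  WeakPeriodicity-unique (aperiodic n)   (periodic y _) = contradiction y (n _)
  WeakPeriodicity-unique (aperiodic _)   (aperiodic _)  = refl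

-- j is the cyclic successor of i among 0, …, n ∸ 1.
Next : ∀ {n} → Fin n → Fin n → Set
Next {n} i j = suc (toℕ i) ≡ toℕ j ⊎ (suc (toℕ i) ≡ n × toℕ j ≡ 0)

-- The cycle C_n for n ≥ 3.  The condition i ≢ j is redundant unless n = 1,
-- where it excludes a loop.
cycle : (n : ℕ) → Graph (Fin n)
cycle n = record
  { Adj        = λ i j → i ≢ j × (Next i j ⊎ Next j i)
  ; adj-sym    = λ (i≢j , next) → ≢-sym i≢j , swap next
  ; adj-irrefl = λ (i≢i , _) → i≢i refl
  }

{-# OPTIONS --safe #-}

-- Let N = kᵖ + 1.  In the circulant graph on ℤ/N with connection set {±a}, where
-- a is coprime to N, a path never turns back, so its end points differ by ±ℓa
-- for ℓ its length.  As 2k ≤ N, the k-distance graph is therefore the circulant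
-- with connection set {±ka}, and the t-th iterate of D k on C_N is the circulant
-- with {±kᵗ}.  It equals {±1} for t = p because kᵖ ≡ −1, and for no 0 < t < p
-- because then 1 < kᵗ < N − 1.
module Submission where

open import Defs using
  ( WeakPeriodicity; cycle; Graph; Walk; []; _∷_; vertices; Path; Distance
  ; Distance-sym; D; iterateD; Returns; periodic; Next)
open import Data.Nat.Base using
  ( ℕ; _+_; _^_; NonTrivial; zero; suc; _*_; _∸_; _≤_; _<_; z≤n; s≤s; z<s
  ; NonZero; pred; >-nonZero; nonTrivial⇒n>1; nonTrivial⇒nonZero)
open import Data.Nat.Properties
open import Data.Nat.DivMod using
  ( _%_; _/_; _mod_; m≡m%n+[m/n]*n; [m+kn]%n≡m%n; m<n⇒m%n≡m
  ; %-distribˡ-+; n%n≡0)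
open import Data.Nat.Divisibility using
  (_∣_; divides; >⇒∤; ∣1⇒≡1; ∣m+n∣m⇒∣n; ∣-trans; m∣m*n)
open import Data.Nat.Coprimality using (Coprime; coprime-divisor)
open import Data.Fin.Base using (Fin; toℕ)
open import Data.Fin.Properties using (toℕ-injective; toℕ<n; toℕ-fromℕ<)
open import Data.List.Membership.Propositional using (_∈_)
open import Data.List.Relation.Unary.All as All using (All; []; _∷_)
open import Data.List.Relation.Unary.AllPairs using ([]; _∷_)
open import Data.List.Relation.Unary.Any using (here)
open import Data.List.Relation.Unary.Unique.Propositional using (Unique)
open import Data.Product.Base using (_×_; _,_; ∃-syntax)
open import Data.Sum.Base using (_⊎_; inj₁; inj₂; swap; [_,_]′)
import Data.Sum.Base as Sum
open import Function.Base using (flip; _∘_)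
open import Function.Bundles using (_⇔_; mk⇔; Equivalence)
import Function.Construct.Composition as Composition
import Function.Construct.Symmetry as Symmetry
open import Relation.Binary.PropositionalEquality
  using (_≡_; refl; sym; trans; cong; subst; module ≡-Reasoning)
open import Relation.Nullary.Negation using (¬_; contradiction)

open Graph using (Adj)
open Equivalence using (to; from)

-- Orientation along paths.

source∈vertices : ∀ {V : Set} {G : Graph V} {ℓ u v} (w : Walk G ℓ u v) → u ∈ vertices w
source∈vertices []      = here refl
source∈vertices (_ ∷ _) = here refl

-- T ℓ is any family that contains the ℓ-th power of the relation R.
module _ {V : Set} {G : Graph V} {R : V → V → Set}
  (R-injective : ∀ {u v w} → R u w → R v w → u ≡ v)
  (oriented : ∀ {u v} → Adj G u v → R u v ⊎ R v u)
  {T : ℕ → V → V → Set} (T-refl : ∀ {u} → T 0 u u)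
  (T-step : ∀ {ℓ u v w} → R u v → T ℓ v w → T (suc ℓ) u w)
  where

  path-keeps-orientation : ∀ {ℓ u x v} (a : Adj G u x) (w : Walk G ℓ x v) →
    Unique (vertices (a ∷ w)) → R u x → T (suc ℓ) u v
  path-keeps-orientation a []      _               r = T-step r T-refl
  path-keeps-orientation a (b ∷ w) ((_ ∷ u∉) ∷ uniq) r with oriented b
  ... | inj₁ r′ = T-step r (path-keeps-orientation b w uniq r′)
  -- A turn makes the vertex after `x` an `R`-predecessor of `x`, as `u` is, so the path would
  -- revisit `u`.
  ... | inj₂ r′ =
    contradiction (R-injective r r′) (All.lookup u∉ (source∈vertices w))

-- Shifts modulo `N`.

module Circulants (N : ℕ) .{{_ : NonZero N}} where

  infix 4 _↝[_]_
  -- A record, so that `u`, `s` and `v` can be inferred from a proof.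
  record _↝[_]_ (u : Fin N) (s : ℕ) (v : Fin N) : Set where
    constructor shift
    field
      shifted : (toℕ u + s) % N ≡ toℕ v

  toℕ-% : (u : Fin N) → toℕ u % N ≡ toℕ u
  toℕ-% u = m<n⇒m%n≡m (toℕ<n u)

  ↝-functional : ∀ {u v w s} → u ↝[ s ] v → u ↝[ s ] w → v ≡ w
  ↝-functional (shift p) (shift q) = toℕ-injective (trans (sym p) q)

  infixl 6 _⊕_
  _⊕_ : Fin N → ℕ → Fin N
  u ⊕ s = (toℕ u + s) mod N

  ↝-⊕ : ∀ u s → u ↝[ s ] u ⊕ s
  ↝-⊕ u s = shift (sym (toℕ-fromℕ< _))

  ↝-trans : ∀ {u v w s t} → u ↝[ s ] v → v ↝[ t ] w → u ↝[ s + t ] w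
  ↝-trans {u} {v} {w} {s} {t} (shift p) (shift q) = shift (begin
    (toℕ u + (s + t)) % N               ≡⟨ cong (_% N) (+-assoc (toℕ u) s t) ⟨
    (toℕ u + s + t) % N                 ≡⟨ %-distribˡ-+ (toℕ u + s) t N ⟩
    ((toℕ u + s) % N + t % N) % N       ≡⟨ cong (λ x → (x + t % N) % N) p ⟩
    (toℕ v + t % N) % N                 ≡⟨ cong (λ x → (x + t % N) % N) (toℕ-% v) ⟨
    (toℕ v % N + t % N) % N             ≡⟨ %-distribˡ-+ (toℕ v) t N ⟨
    (toℕ v + t) % N                     ≡⟨ q ⟩
    toℕ w                               ∎)
    where open ≡-Reasoning

  ↝-cong : ∀ {u v s t} → s ≡ t → u ↝[ s ] v → u ↝[ t ] v
  ↝-cong refl p = p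

  ∣⇒↝ : ∀ {s} → N ∣ s → ∀ u → u ↝[ s ] u
  ∣⇒↝ (divides q refl) u = shift (trans ([m+kn]%n≡m%n (toℕ u) q N) (toℕ-% u))

  ↝⇒∣ : ∀ {u s} → u ↝[ s ] u → N ∣ s
  ↝⇒∣ {u} {s} (shift p) = divides q (+-cancelˡ-≡ (toℕ u) s (q * N)
    (trans (m≡m%n+[m/n]*n (toℕ u + s) N) (cong (_+ q * N) p)))
    where q = (toℕ u + s) / N

  -- Moving `v` on by `t` completes a shift of `u` by `s + t`, and that shift has only one target.
  ↝-split : ∀ {u v w s t} → u ↝[ s + t ] w → u ↝[ s ] v → v ↝[ t ] w
  ↝-split {v = v} {t = t} p q =
    subst (v ↝[ t ]_) (↝-functional (↝-trans q (↝-⊕ v t)) p) (↝-⊕ v t)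

  ↝-refl : ∀ {u} → u ↝[ 0 ] u
  ↝-refl = ∣⇒↝ (divides 0 refl) _

  ↝-sym : ∀ {u v s t} → N ∣ s + t → u ↝[ s ] v → v ↝[ t ] u
  ↝-sym N∣s+t = ↝-split (∣⇒↝ N∣s+t _)

  ↝-injective : ∀ {u v w s} → u ↝[ s ] w → v ↝[ s ] w → u ≡ v
  ↝-injective {s = s} p q = ↝-functional (↝-sym N∣ p) (↝-sym N∣ q)
    where
    -- The multiple `s * pred N` serves as `−s`: together with `s` it makes `s * N`.
    N∣ : N ∣ s + s * pred N
    N∣ = divides s (trans (sym (*-suc s (pred N))) (cong (s *_) (suc-pred N)))

  ↝⇒∣∸ : ∀ {u v s t} → s ≤ t → u ↝[ s ] v → u ↝[ t ] v → N ∣ t ∸ s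
  ↝⇒∣∸ s≤t p q = ↝⇒∣ (↝-split (↝-cong (sym (m+[n∸m]≡n s≤t)) q) p)

  -- Circulant graphs and their distance graphs.

  Circulant : ℕ → Graph (Fin N) → Set
  Circulant a G = ∀ u v → Adj G u v ⇔ (u ↝[ a ] v ⊎ v ↝[ a ] u)

  module _ {a : ℕ} {G : Graph (Fin N)} (circ : Circulant a G) where

    path⇒shift : ∀ {ℓ u v} → Path G ℓ u v → u ↝[ ℓ * a ] v ⊎ v ↝[ ℓ * a ] u
    path⇒shift ([] , _)           = inj₁ ↝-refl
    path⇒shift (_∷_ {ℓ} b w , uniq) = Sum.map
      (path-keeps-orientation {G = G} {R = _↝[ a ]_} ↝-injective (to (circ _ _))
        {T = λ ℓ u v → u ↝[ ℓ * a ] v} ↝-refl ↝-trans b w uniq)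
      -- For a path that starts with `−a` the relation is flipped, so functionality acts as
      -- injectivity. Each step then joins on at the far end, whence the commutation.
      (path-keeps-orientation {G = G} {R = flip _↝[ a ]_} ↝-functional
        (swap ∘ to (circ _ _))
        {T = λ ℓ u v → v ↝[ ℓ * a ] u} ↝-refl
        (λ {ℓ} r p → ↝-cong (+-comm (ℓ * a) a) (↝-trans p r)) b w uniq)
      (to (circ _ _) b)

    module _ (coprime : Coprime N a) where

      -- Coprimality passes the divisibility on to `n`, which is positive and too small.
      N∤multiple : ∀ {n} → 0 < n → n < N → ¬ (N ∣ n * a)
      N∤multiple {n} 0<n n<N N∣na =
        >⇒∤ {{>-nonZero 0<n}} n<N
          (coprime-divisor coprime (subst (N ∣_) (*-comm n a) N∣na))

      straight : ∀ n {u v} → u ↝[ n * a ] v → Walk G n u v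
      straight zero    p with refl ← ↝-functional ↝-refl p = []
      straight (suc n) {u} p =
        from (circ _ _) (inj₁ (↝-⊕ u a)) ∷ straight n (↝-split p (↝-⊕ u a))

      straight-vertices : ∀ n {u v} (p : u ↝[ n * a ] v) →
        All (λ x → ∃[ i ] i ≤ n × u ↝[ i * a ] x) (vertices (straight n p))
      straight-vertices zero    p with refl ← ↝-functional ↝-refl p =
        (0 , z≤n , ↝-refl) ∷ []
      straight-vertices (suc n) {u} p =
        (0 , z≤n , ↝-refl) ∷
        All.map (λ (i , i≤n , q) → suc i , s≤s i≤n , ↝-trans (↝-⊕ u a) q)
          (straight-vertices n (↝-split p (↝-⊕ u a)))

      -- A vertex that recurred after `suc i` steps would make `suc i * a` a multiple of `N`, with
      -- `suc i < N`.
      straight-unique : ∀ n {u v} (p : u ↝[ n * a ] v) → n < N →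
        Unique (vertices (straight n p))
      straight-unique zero    p _ with refl ← ↝-functional ↝-refl p = [] ∷ []
      straight-unique (suc n) {u} p n<N =
        All.map
          (λ { (i , i≤n , q) refl →
               N∤multiple z<s (≤-<-trans (s≤s i≤n) n<N) (↝⇒∣ (↝-trans (↝-⊕ u a) q)) })
          (straight-vertices n p′)
        ∷ straight-unique n p′ (<-trans (n<1+n n) n<N)
        where p′ = ↝-split p (↝-⊕ u a)

      -- The straight path has length `n`. A path of length `ℓ < n` would make `N` divide
      -- `(n − ℓ) a` or `(n + ℓ) a`, according to its direction; `n + n ≤ N` keeps `n + ℓ` below
      -- `N`.
      shift⇒distance : ∀ {n u v} → n + n ≤ N → n < N → u ↝[ n * a ] v →
        Distance G u v n
      shift⇒distance {n} {u} {v} 2n≤N n<N p =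
        (straight n p , straight-unique n p n<N) ,
        λ {ℓ} q → ≮⇒≥ λ ℓ<n → [ forward ℓ<n , backward ℓ<n ]′ (path⇒shift q)
        where
        forward : ∀ {ℓ} → ℓ < n → ¬ u ↝[ ℓ * a ] v
        forward {ℓ} ℓ<n q =
          N∤multiple (m<n⇒0<n∸m ℓ<n) (≤-<-trans (m∸n≤m n ℓ) n<N)
            (subst (N ∣_) (sym (*-distribʳ-∸ a n ℓ))
              (↝⇒∣∸ (*-monoˡ-≤ a (<⇒≤ ℓ<n)) q p))

        backward : ∀ {ℓ} → ℓ < n → ¬ v ↝[ ℓ * a ] u
        backward {ℓ} ℓ<n q =
          N∤multiple (≤-<-trans z≤n (<-≤-trans ℓ<n (m≤m+n n ℓ)))
            (<-≤-trans (+-monoʳ-< n ℓ<n) 2n≤N)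
            (subst (N ∣_) (sym (*-distribʳ-+ a n ℓ)) (↝⇒∣ (↝-trans p q)))

      D-circulant : ∀ k .{{_ : NonTrivial k}} → k + k ≤ N → k < N →
        Circulant (k * a) (D k G)
      D-circulant k 2k≤N k<N u v = mk⇔
        (λ (path , _) → path⇒shift path)
        [ shift⇒distance 2k≤N k<N
        , (λ p → Distance-sym (shift⇒distance 2k≤N k<N p)) ]′

  -- A common divisor of `N` and `k * k ^ t` is itself coprime to `k`, so it divides `k ^ t`.
  coprime-^ : ∀ {k} → Coprime N k → ∀ t → Coprime N (k ^ t)
  coprime-^ _ zero    (_ , d∣1)     = ∣1⇒≡1 d∣1
  coprime-^ c (suc t) (d∣N , d∣k*kᵗ) =
    coprime-^ c t (d∣N , coprime-divisor
      (λ (e∣d , e∣k) → c (∣-trans e∣d d∣N , e∣k)) d∣k*kᵗ)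

  -- Index `suc t` means `t` applications of `D k`, and each multiplies the connection by `k`.
  iterateD-circulant : ∀ k .{{_ : NonTrivial k}} → Coprime N k → k + k ≤ N → k < N →
    ∀ {G} → Circulant 1 G → ∀ t → Circulant (k ^ t) (iterateD k G (suc t))
  iterateD-circulant k c 2k≤N k<N circ zero    = circ
  iterateD-circulant k c 2k≤N k<N circ (suc t) =
    D-circulant (iterateD-circulant k c 2k≤N k<N circ t) (coprime-^ c t) k 2k≤N k<N

  -- The cycle as a circulant.

  Next⇔↝ : ∀ {u v : Fin N} → Next u v ⇔ u ↝[ 1 ] v
  Next⇔↝ {u} {v} = mk⇔ ⇒ ⇐
    where
    ⇒ : Next u v → u ↝[ 1 ] v
    ⇒ (inj₁ eq) = shift (trans (cong (_% N) (trans (+-comm (toℕ u) 1) eq)) (toℕ-% v))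
    ⇒ (inj₂ (eq , v≡0)) = shift (trans (cong (_% N) (trans (+-comm (toℕ u) 1) eq))
                                  (trans (n%n≡0 N) (sym v≡0)))

    ⇐ : u ↝[ 1 ] v → Next u v
    ⇐ (shift p) rewrite +-comm (toℕ u) 1 with m≤n⇒m<n∨m≡n (toℕ<n u)
    ... | inj₁ 1+u<N = inj₁ (trans (sym (m<n⇒m%n≡m 1+u<N)) p)
    ... | inj₂ 1+u≡N =
      inj₂ (1+u≡N , trans (sym p) (trans (cong (_% N) 1+u≡N) (n%n≡0 N)))

  cycle-circulant : 1 < N → Circulant 1 (cycle N)
  cycle-circulant 1<N u v = mk⇔
    (λ (_ , next) → Sum.map (to Next⇔↝) (to Next⇔↝) next)
    -- The condition `u ≢ v` comes from `1 < N`: a shift by `1` fixes no vertex.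
    (λ p → (λ { refl → [ loopless , loopless ]′ p }) ,
           Sum.map (from Next⇔↝) (from Next⇔↝) p)
    where
    loopless : ∀ {w} → ¬ w ↝[ 1 ] w
    loopless p = >⇒∤ 1<N (↝⇒∣ p)

-- The modulus `k ^ p + 1`.

module _ (k p : ℕ) .{{_ : NonTrivial k}} .{{_ : NonTrivial p}} where

  private
    N : ℕ
    N = k ^ p + 1

    instance
      k≢0 : NonZero k
      k≢0 = nonTrivial⇒nonZero k

      N≢0 : NonZero N
      N≢0 = >-nonZero (<-≤-trans z<s (m≤n+m 1 (k ^ p)))

    open Circulants N

    1<k : 1 < k
    1<k = nonTrivial⇒n>1 k

    0<p : 0 < p
    0<p = <-trans z<s (nonTrivial⇒n>1 p)

    kᵗ<N-1 : ∀ {t} → t < p → k ^ t < k ^ p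
    kᵗ<N-1 = ^-monoʳ-< k 1<k

    -- Here `p > 1` is used in full strength: the bound fails for `p = 1`.
    2k≤kᵖ : k + k ≤ k ^ p
    2k≤kᵖ = begin
      k + k   ≡⟨ cong (k +_) (+-identityʳ k) ⟨
      2 * k   ≤⟨ *-monoˡ-≤ k 1<k ⟩
      k * k   ≡⟨ cong (k *_) (*-identityʳ k) ⟨
      k ^ 2   ≤⟨ ^-monoʳ-≤ k (nonTrivial⇒n>1 p) ⟩
      k ^ p   ∎
      where open ≤-Reasoning

    2k≤N : k + k ≤ N
    2k≤N = ≤-trans 2k≤kᵖ (m≤m+n _ 1)

    k<N : k < N
    k<N = <-≤-trans (m<m+n k (<-trans z<s 1<k)) 2k≤N

    -- A common divisor divides `k ^ p`, hence also the remaining summand `1`.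
    N-k-coprime : Coprime N k
    N-k-coprime (d∣N , d∣k) =
      ∣1⇒≡1 (∣m+n∣m⇒∣n d∣N (∣-trans d∣k k∣kᵖ))
      where
      k∣kᵖ : k ∣ k ^ p
      k∣kᵖ = subst (λ q → k ∣ k ^ q) (suc-pred p {{>-nonZero 0<p}}) (m∣m*n (k ^ pred p))

    C-circulant : Circulant 1 (cycle N)
    C-circulant = cycle-circulant (<-trans 1<k k<N)

    iterate-circulant : ∀ t → Circulant (k ^ t) (iterateD k (cycle N) (suc t))
    iterate-circulant = iterateD-circulant k N-k-coprime 2k≤N k<N C-circulant

    kᵖ≡-1 : N ∣ k ^ p + 1
    kᵖ≡-1 = divides 1 (sym (+-identityʳ N))

  returns : Returns k (cycle N) (suc p)
  returns = s≤s 0<p , λ u v → Composition.equivalence (iterate-circulant p u v)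
    (Composition.equivalence reverse-shifts (Symmetry.equivalence (C-circulant u v)))
    where
    reverse-shifts : ∀ {u v} →
      (u ↝[ k ^ p ] v ⊎ v ↝[ k ^ p ] u) ⇔ (u ↝[ 1 ] v ⊎ v ↝[ 1 ] u)
    reverse-shifts = mk⇔
      -- A shift by `k ^ p` one way is a shift by `1` the other way, so the two disjuncts trade
      -- places.
      (swap ∘ Sum.map (↝-sym kᵖ≡-1) (↝-sym kᵖ≡-1))
      (swap ∘ Sum.map (↝-sym 1+kᵖ≡0) (↝-sym 1+kᵖ≡0))
      where
      1+kᵖ≡0 : N ∣ 1 + k ^ p
      1+kᵖ≡0 = subst (N ∣_) (+-comm (k ^ p) 1) kᵖ≡-1

  -- One edge suffices as a test: if `t < p`, the edge of the cycle from `0` to `1` would survive in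
  -- the iterate and force `k ^ t` to be `1` or `−1` modulo `N`.
  minimal : ∀ {g} → Returns k (cycle N) g → suc p ≤ g
  minimal {suc zero}      (s≤s () , _)
  minimal {suc t@(suc s)} (_ , same) = s≤s (≮⇒≥ λ t<p →
    let u = 0 mod N
        v = u ⊕ 1
        e = ↝-⊕ u 1
    in [ +1≢kᵗ t<p e , -1≢kᵗ t<p e ]′
         (to (iterate-circulant t u v)
           (from (same u v) (from (C-circulant u v) (inj₁ e)))))
    where
    1<kᵗ : 1 < k ^ t
    1<kᵗ = ^-monoʳ-< k 1<k {0} {t} z<s

    -- Otherwise `N` divides `k ^ t ∸ 1`, which is positive and less than `N`.
    +1≢kᵗ : t < p → ∀ {u v} → u ↝[ 1 ] v → ¬ u ↝[ k ^ t ] v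
    +1≢kᵗ t<p e q = >⇒∤ {{>-nonZero (m<n⇒0<n∸m 1<kᵗ)}}
      (≤-<-trans (m∸n≤m (k ^ t) 1) (<-≤-trans (kᵗ<N-1 t<p) (m≤m+n _ 1)))
      (↝⇒∣∸ (<⇒≤ 1<kᵗ) e q)

    -- Otherwise `N` divides `1 + k ^ t`, which is at most `k ^ p`.
    -1≢kᵗ : t < p → ∀ {u v} → u ↝[ 1 ] v → ¬ v ↝[ k ^ t ] u
    -1≢kᵗ t<p e q = >⇒∤
      (subst (suc (k ^ t) <_) (+-comm 1 (k ^ p)) (s≤s (kᵗ<N-1 t<p)))
      (↝⇒∣ (↝-trans e q))

theorem1 : (k p : ℕ) .{{_ : NonTrivial k}} .{{_ : NonTrivial p}} →
    WeakPeriodicity k (cycle (k ^ p + 1)) p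
theorem1 k p = periodic (returns k p) (minimal k p)
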